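{- Let $m\in\mathbb N$, $M\in{\rm Mat}_m(\mathbb Z)$, and let $S\in{\rm Mat}_m(\mathbb Z)\cap GL_m(\mathbb Q)$ be such that $S^{ -1}MS$ is the rational canonical form of $M$. Then for every prime $p$ with $\gcd(\det(S),p)=1$ and for which $M$ has finite $\mathbb Z_p$-order $k$, the move graph $\Gamma_{M,\,p}$ contains a directed $k$-cycle.
   Context: $\mathbb Z_n$ denotes the integers modulo $n$. For $M\in{\rm Mat}_m(\mathbb Z)$, the move graph $\Gamma_{M,\,n}$ is the directed graph with vertex set $\mathbb Z_n^m$ and arc set $\{({\bf x},{\bf y}) : {\bf y}^T=M{\bf x}^T \text{ in } \mathbb Z_n^m\}$ (loops allowed). The $\mathbb Z_n$-order of $M$ is the least positive integer $k$ (if it exists) such that $M^k$ acts as the identity on $\mathbb Z_n^m$. A directed $k$-cycle is a cycle of length $k$ in the underlying undirected graph such that in the induced directed subgraph on it every vertex has in-degree and out-degree $1$ (a loop counts as a directed $1$-cycle, a pair of opposite arcs as a directed $2$-cycle). -}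

module Defs where

open import Algebra.Bundles using (CommutativeRing)
open import Data.Bool.Base using (if_then_else_)
open import Data.Fin.Base using (Fin; zero; suc; toℕ; cast)
open import Data.Fin.Properties using (_≟_; nonZeroIndex)
open import Data.Integer.Base as ℤ using (ℤ; +_)
open import Data.Integer.Divisibility.Signed using (_∣_)
import Data.Integer.Properties as ℤ
open import Data.List.Base as List using (List; []; _∷_)
open import Data.List.Relation.Unary.All using (All)
open import Data.List.Relation.Unary.Linked using (Linked)
open import Data.Nat.Base as ℕ using (ℕ; zero; suc)
open import Data.Nat.DivMod using (_mod_)
import Data.Nat.Properties as ℕ
open import Data.Product using (Σ-syntax; ∃-syntax; ∃!; _×_)
open import Data.Rational.Base using (ℚ; _/_)
import Data.Rational.Properties as ℚ
open import Data.Vec.Base as Vec using (Vec)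
open import Data.Vec.Functional using (Vector; _++_; replicate; removeAt; toList)
open import Function.Definitions using (Injective)
open import Level using (Level; 0ℓ; _⊔_)
open import Relation.Binary.Construct.Closure.Symmetric using (SymClosure)
open import Relation.Binary.Core using (Rel)
open import Relation.Binary.PropositionalEquality.Core using (_≡_)
open import Relation.Nullary.Decidable.Core using (does)

private
  variable
    a : Level
    A : Set a
    m n : ℕ

Matrix : Set a → ℕ → Set a
Matrix A m = Fin m → Fin m → A

module Matrices {c ℓ} (R : CommutativeRing c ℓ) where

  open CommutativeRing R hiding (zero)
  open import Algebra.Properties.Semiring.Exp semiring using (_^_)
  open import Algebra.Properties.Semiring.Sum semiring using (sum)

  Mat : ℕ → Set c
  Mat = Matrix Carrier

  infix  4 _≋_
  infixl 7 _·_ _·ᵥ_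
  infixr 6 _⊕_
  infixr 8 _^ᵐ_

  _≋_ : Mat m → Mat m → Set ℓ
  A ≋ B = ∀ i j → A i j ≈ B i j

  𝟙 : Mat m
  𝟙 i j = if does (i ≟ j) then 1# else 0#

  _·_ : Mat m → Mat m → Mat m
  (A · B) i j = sum λ l → A i l * B l j

  _·ᵥ_ : Mat m → Vector Carrier m → Vector Carrier m
  (A ·ᵥ x) i = sum λ j → A i j * x j

  _^ᵐ_ : Mat m → ℕ → Mat m
  A ^ᵐ zero  = 𝟙
  A ^ᵐ suc k = A · A ^ᵐ k

  -- Laplace expansion along the first row.
  det : Mat m → Carrier
  det {zero}  A = 1#
  det {suc m} A =
    sum λ j → (- 1#) ^ toℕ j * (A zero j * det (λ i → removeAt (A (suc i)) j))

  IsInverse : Mat m → Mat m → Set ℓ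
  IsInverse P Q = (P · Q ≋ 𝟙) × (Q · P ≋ 𝟙)

  Similar : Mat m → Mat m → Set (c ⊔ ℓ)
  Similar A B = ∃[ P ] ∃[ Q ] IsInverse P Q × (Q · A · P ≋ B)

  _⊕_ : Mat m → Mat n → Mat (m ℕ.+ n)
  _⊕_ {m} {n} A B = (λ i → A i ++ replicate n 0#) ++ (λ i → replicate m 0# ++ B i)

  -- Coefficient lists, constant term first; trailing zeros are not significant,
  -- so polynomials are compared by _≈ₚ_.
  Poly : Set c
  Poly = List Carrier

  coeff : Poly → ℕ → Carrier
  coeff []      i       = 0#
  coeff (a ∷ f) zero    = a
  coeff (a ∷ f) (suc i) = coeff f i

  infix  4 _≈ₚ_ _∣ₚ_
  infixl 6 _+ₚ_
  infixl 7 _*ₚ_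

  _≈ₚ_ : Poly → Poly → Set ℓ
  f ≈ₚ g = ∀ i → coeff f i ≈ coeff g i

  _+ₚ_ : Poly → Poly → Poly
  []      +ₚ g       = g
  (a ∷ f) +ₚ []      = a ∷ f
  (a ∷ f) +ₚ (b ∷ g) = (a + b) ∷ (f +ₚ g)

  _*ₚ_ : Poly → Poly → Poly
  []      *ₚ g = []
  (a ∷ f) *ₚ g = List.map (a *_) g +ₚ (0# ∷ (f *ₚ g))

  _∣ₚ_ : Poly → Poly → Set (c ⊔ ℓ)
  f ∣ₚ g = ∃[ h ] f *ₚ h ≈ₚ g

  -- The monic polynomial x^d + b_{d-1} x^{d-1} + ⋯ + b_0, where d = degree and
  -- b_i = lower i.
  record Monic : Set c where
    field
      degree : ℕ
      lower  : Vector Carrier degree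

  open Monic public

  toPoly : Monic → Poly
  toPoly f = toList (lower f) List.++ (1# ∷ [])

  -- Ones on the subdiagonal, -b_0, …, -b_{d-1} down the last column.
  companion : (f : Monic) → Mat (degree f)
  companion f i j =
    if does (suc (toℕ j) ℕ.≟ degree f) then - lower f i
    else if does (toℕ i ℕ.≟ suc (toℕ j)) then 1#
    else 0#

  totalDegree : List Monic → ℕ
  totalDegree []       = 0
  totalDegree (f ∷ fs) = degree f ℕ.+ totalDegree fs

  companions : (fs : List Monic) → Mat (totalDegree fs)
  companions []       = λ ()
  companions (f ∷ fs) = companion f ⊕ companions fs

  -- The shape of a list of invariant factors: nonconstant monic polynomials
  -- f₁ ∣ f₂ ∣ ⋯ ∣ fᵣ.
  InvariantFactors : List Monic → Set (c ⊔ ℓ)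
  InvariantFactors fs =
    All (λ f → 1 ℕ.≤ degree f) fs × Linked (λ f g → toPoly f ∣ₚ toPoly g) fs

  InRationalCanonicalForm : Mat m → Set (c ⊔ ℓ)
  InRationalCanonicalForm {m} C =
    ∃[ fs ] InvariantFactors fs ×
      (Σ[ eq ∈ m ≡ totalDegree fs ]
        (∀ i j → C i j ≈ companions fs (cast eq i) (cast eq j)))

  IsRationalCanonicalFormOf : Mat m → Mat m → Set (c ⊔ ℓ)
  IsRationalCanonicalFormOf A C = Similar A C × InRationalCanonicalForm C

module ℤMat = Matrices ℤ.+-*-commutativeRing
module ℚMat = Matrices ℚ.+-*-commutativeRing

toℚMat : Matrix ℤ m → Matrix ℚ m
toℚMat A i j = A i j / 1

record Digraph : Set₁ where
  field
    Vertex : Set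
    Arc    : Rel Vertex 0ℓ

next : Fin n → Fin n
next {n} i = (suc (toℕ i) mod n) {{nonZeroIndex i}}

-- inDegree and outDegree say that these degrees are 1 in the subgraph induced on
-- the vertices of the cycle. For k = 1 the record amounts to a loop, and for k = 2
-- to a pair of opposite arcs.
record DirectedCycle (G : Digraph) (k : ℕ) : Set where
  open Digraph G
  field
    positive  : 0 ℕ.< k
    vertex    : Fin k → Vertex
    distinct  : Injective _≡_ _≡_ vertex
    adjacent  : ∀ i → SymClosure Arc (vertex i) (vertex (next i))
    inDegree  : ∀ i → ∃! _≡_ λ j → Arc (vertex j) (vertex i)
    outDegree : ∀ i → ∃! _≡_ λ j → Arc (vertex i) (vertex j)

infix 4 _≡_[mod_]

_≡_[mod_] : ℤ → ℤ → ℕ → Set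
i ≡ j [mod n ] = + n ∣ i ℤ.- j

-- ℤₙᵐ for n ≥ 1, with elements of ℤₙ given by their residues 0, …, n-1.
Residues : ℕ → ℕ → Set
Residues n m = Vec (Fin n) m

lift : Residues n m → Vector ℤ m
lift x i = + toℕ (Vec.lookup x i)

-- yᵀ = M xᵀ in ℤₙᵐ.
MapsTo : ∀ n → Matrix ℤ m → Residues n m → Residues n m → Set
MapsTo n M x y = ∀ i → lift y i ≡ (M ℤMat.·ᵥ lift x) i [mod n ]

moveGraph : Matrix ℤ m → ℕ → Digraph
moveGraph {m} M n = record { Vertex = Residues n m ; Arc = MapsTo n M }

ActsAsIdentity : ℕ → Matrix ℤ m → Set
ActsAsIdentity n M = ∀ x → MapsTo n M x x

record IsOrder (n : ℕ) (M : Matrix ℤ m) (k : ℕ) : Set where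
  field
    positive : 0 ℕ.< k
    identity : ActsAsIdentity n (M ℤMat.^ᵐ k)
    least    : ∀ j → 0 ℕ.< j → ActsAsIdentity n (M ℤMat.^ᵐ j) → k ℕ.≤ j

{-# OPTIONS --safe #-}
module Submission where

-- A matrix T of order k over ℤ_p has a vector v with T^d v ≠ v for every d = k/q,
-- q a prime divisor of k; the orbit of v is then a directed k-cycle, because
-- T^j v = v implies T^gcd(j,k) v = v. Such a v is built prime by prime: it is chosen
-- outside ker(T^(k/p) - 1) first, and for a prime q ≠ p the averaging operator
-- Σ_{i<q} T^(ik/q) splits off ker(T^(k/q) - 1) as a T-invariant direct summand, so v
-- can be corrected by a vector of the complement without spoiling the earlier primes.

open import Defs
open import Algebra.Bundles using (AbelianGroup; CommutativeRing)
import Algebra.Construct.Pointwise as Pointwise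
open import Algebra.Morphism.Structures using (IsMonoidHomomorphism)
import Algebra.Morphism.Construct.Composition as Composition
import Algebra.Morphism.Construct.Identity as Identity
open import Data.Fin.Base as Fin using (Fin; toℕ; fromℕ<; finToFun; funToFin)
open import Data.Fin.Properties as Fin using (all?)
open import Data.Integer.Base using (ℤ; +_; 1ℤ)
import Data.Integer.Base as ℤ
import Data.Integer.Divisibility.Signed as ℤ∣
open import Data.Integer.DivMod using (_%ℕ_; _/ℕ_; n%ℕd<d; a≡a%ℕn+[a/ℕn]*n)
import Data.Integer.Properties as ℤ
open import Data.Integer.Tactic.RingSolver using (solve-∀)
open import Data.Integer.GCD using (gcd)
open import Data.List.Base using ([]; _∷_)
open import Data.List.Relation.Unary.All using (_∷_)
open import Data.Nat.Base as ℕ using (ℕ; zero; suc; _<_; s≤s; z<s; s<s)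
open import Data.Nat.Coprimality using (Coprime; coprime-Bézout)
open import Data.Nat.Divisibility using (_∣_; divides; divides-refl)
import Data.Nat.Divisibility as Div
open import Data.Nat.GCD using (module Bézout; gcd-GCD; gcd[m,n]∣m; gcd[m,n]∣n)
import Data.Nat.GCD as GCD
open import Data.Nat.ListAction using (product)
open import Data.Nat.GeneralisedArithmetic using (fold; fold-+)
open import Data.Nat.Primality
  using (Prime; prime?; prime⇒nonTrivial; prime⇒nonZero; prime⇒irreducible)
open import Data.Nat.Primality.Factorisation using (factorise)
open import Data.Nat.DivMod using (_%_; _/_; _mod_; m%n<n; m≡m%n+[m/n]*n)
import Data.Nat.Properties as ℕ
open import Data.Product using (_×_; _,_; ∃-syntax)
open import Data.Rational.Base using (ℚ)
open import Data.Sum.Base using (_⊎_; inj₁; inj₂)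
open import Data.Vec.Base using (lookup; tabulate)
open import Data.Vec.Functional using (Vector)
open import Data.Vec.Properties using (lookup∘tabulate; tabulate∘lookup; tabulate-cong)
open import Relation.Binary.Construct.Closure.Symmetric using (fwd)
open import Relation.Binary.Definitions using (Decidable; tri<; tri≈; tri>)
open import Relation.Binary.PropositionalEquality
  using (_≡_; _≢_; refl; cong; subst; module ≡-Reasoning)
import Relation.Binary.PropositionalEquality as ≡
import Relation.Binary.Reasoning.Setoid as SetoidReasoning
open import Relation.Nullary using (¬_; Dec; yes; no; contradiction)

-- Prime divisors and proper divisors of natural numbers.

prime-divisor : ∀ {n} → 1 < n → ∃[ q ] Prime q × q ∣ n
prime-divisor {n@(suc _)} 1<n with factorise n
... | record { factors = [] ; isFactorisation = eq } = contradiction (≡.sym eq) (ℕ.<⇒≢ 1<n)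
... | record { factors = q ∷ qs ; isFactorisation = eq ; factorsPrime = q-prime ∷ _ } =
  q , q-prime , divides (product qs) (≡.trans eq (ℕ.*-comm q (product qs)))

distinct-primes-coprime : ∀ {q p} → Prime q → Prime p → q ≢ p → Coprime q p
distinct-primes-coprime q-prime p-prime q≢p (d∣q , d∣p)
  with prime⇒irreducible q-prime d∣q | prime⇒irreducible p-prime d∣p
... | inj₁ d≡1  | _         = d≡1
... | inj₂ _    | inj₁ d≡1  = d≡1
... | inj₂ refl | inj₂ refl = contradiction refl q≢p

-- Write `k = c g` with `c` at least 2, choose a prime `q` with `c = r q`, and take `d = r g`. Thus,
-- to exclude all proper divisors of `k` as periods, it is enough to exclude the exponents `k/q`
-- with `q` prime.
maximal-proper-divisor : ∀ {g k} → 0 < k → g < k → g ∣ k →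
                         ∃[ q ] ∃[ d ] Prime q × q ℕ.* d ≡ k × g ∣ d
maximal-proper-divisor         0<k g<k (divides-refl zero)       = contradiction 0<k λ ()
maximal-proper-divisor {g}     0<k g<k (divides-refl (suc zero)) =
  contradiction (≡.sym (ℕ.+-identityʳ g)) (ℕ.<⇒≢ g<k)
maximal-proper-divisor {g} {k} 0<k g<k (divides c@(suc (suc _)) k≡cg)
  with q , q-prime , divides r c≡rq ← prime-divisor {c} (s<s z<s) =
  q , r ℕ.* g , q-prime , qrg≡k , divides-refl r
  where
  open ≡-Reasoning
  qrg≡k : q ℕ.* (r ℕ.* g) ≡ k
  qrg≡k = begin
    q ℕ.* (r ℕ.* g)  ≡⟨ ℕ.*-assoc q r g ⟨
    q ℕ.* r ℕ.* g    ≡⟨ cong (ℕ._* g) (ℕ.*-comm q r) ⟩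
    r ℕ.* q ℕ.* g    ≡⟨ cong (ℕ._* g) c≡rq ⟨
    c ℕ.* g          ≡⟨ k≡cg ⟨
    k                ∎

-- Endomorphisms of an additively written abelian group and their orbit sums.

module Endomorphisms {c ℓ} (V : AbelianGroup c ℓ) where

  open AbelianGroup V public
    using (Carrier; _≈_; setoid; rawMonoid; group; commutativeMonoid)
    renaming ( _∙_ to _+_; ε to 0#; _⁻¹ to -_; ∙-cong to +-cong; ∙-congˡ to +-congˡ
             ; ∙-congʳ to +-congʳ; assoc to +-assoc; comm to +-comm
             ; identityˡ to +-identityˡ; identityʳ to +-identityʳ
             ; inverseˡ to -‿inverseˡ
             ; refl to ≈-refl; sym to ≈-sym; trans to ≈-trans; reflexive to ≈-reflexive)
  open import Algebra.Properties.Group group public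
    using (identityˡ-unique; inverseˡ-unique; ∙-cancelˡ)
  open import Algebra.Properties.CommutativeMonoid.Mult commutativeMonoid public
    using (×-congʳ; ×-assocˡ)
    renaming (_×_ to infixr 8 _⋆_)
  open import Algebra.Properties.CommutativeSemigroup
    (AbelianGroup.commutativeSemigroup V) public using (interchange)
  open SetoidReasoning setoid

  IsEndo : (Carrier → Carrier) → Set _
  IsEndo = IsMonoidHomomorphism rawMonoid rawMonoid

  module _ {U : Carrier → Carrier} (U-endo : IsEndo U) where
    open IsMonoidHomomorphism U-endo

    ⋆-homo : ∀ n x → U (n ⋆ x) ≈ n ⋆ U x
    ⋆-homo zero    x = ε-homo
    ⋆-homo (suc n) x = ≈-trans (homo x (n ⋆ x)) (+-congˡ (⋆-homo n x))

    fold-endo : ∀ n → IsEndo (λ x → fold x U n)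
    fold-endo zero    = Identity.isMonoidHomomorphism rawMonoid ≈-refl
    fold-endo (suc n) = Composition.isMonoidHomomorphism ≈-trans (fold-endo n) U-endo

    -- This is `x + U x + … + U^(n-1) x` in Horner form, so that inductions on `n` meet no powers of
    -- `U`.
    orbitSum : ℕ → Carrier → Carrier
    orbitSum zero    x = 0#
    orbitSum (suc n) x = x + U (orbitSum n x)

    orbitSum-cong : ∀ n {x y} → x ≈ y → orbitSum n x ≈ orbitSum n y
    orbitSum-cong zero    x≈y = ≈-refl
    orbitSum-cong (suc n) x≈y = +-cong x≈y (⟦⟧-cong (orbitSum-cong n x≈y))

    orbitSum-homo : ∀ n x y → orbitSum n (x + y) ≈ orbitSum n x + orbitSum n y
    orbitSum-homo zero    x y = ≈-sym (+-identityˡ 0#)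
    orbitSum-homo (suc n) x y = begin
      x + y + U (orbitSum n (x + y))
        ≈⟨ +-congˡ (≈-trans (⟦⟧-cong (orbitSum-homo n x y)) (homo _ _)) ⟩
      x + y + (U (orbitSum n x) + U (orbitSum n y))
        ≈⟨ interchange x y _ _ ⟩
      orbitSum (suc n) x + orbitSum (suc n) y ∎

    orbitSum-0# : ∀ n → orbitSum n 0# ≈ 0#
    orbitSum-0# zero    = ≈-refl
    orbitSum-0# (suc n) = ≈-trans (+-identityˡ _) (≈-trans (⟦⟧-cong (orbitSum-0# n)) ε-homo)

    orbitSum-endo : ∀ n → IsEndo (orbitSum n)
    orbitSum-endo n = record
      { isMagmaHomomorphism = record
        { isRelHomomorphism = record { cong = orbitSum-cong n }
        ; homo              = orbitSum-homo n
        }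
      ; ε-homo = orbitSum-0# n
      }

    orbitSum-fixed : ∀ n {x} → U x ≈ x → orbitSum n x ≈ n ⋆ x
    orbitSum-fixed zero    Ux≈x = ≈-refl
    orbitSum-fixed (suc n) Ux≈x = +-congˡ
      (≈-trans (⟦⟧-cong (orbitSum-fixed n Ux≈x)) (≈-trans (⋆-homo n _) (×-congʳ n Ux≈x)))

    -- Both sides are the sum of `U^i x` over `0 ≤ i ≤ n`, with the first term split off on the left
    -- and the last term on the right.
    orbitSum-shift : ∀ n x → x + U (orbitSum n x) ≈ orbitSum n x + fold x U n
    orbitSum-shift zero    x = ≈-trans (+-congˡ ε-homo) (+-comm x 0#)
    orbitSum-shift (suc n) x = begin
      x + U (x + U (orbitSum n x))             ≈⟨ +-congˡ (⟦⟧-cong (orbitSum-shift n x)) ⟩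
      x + U (orbitSum n x + fold x U n)        ≈⟨ +-congˡ (homo _ _) ⟩
      x + (U (orbitSum n x) + U (fold x U n))  ≈⟨ +-assoc _ _ _ ⟨
      x + U (orbitSum n x) + U (fold x U n)    ∎

    -- When `U^n x = x`, applying `U` permutes the summands cyclically; formally, `x` is cancelled
    -- from both sides of `orbitSum-shift`.
    orbitSum-invariant : ∀ n {x} → fold x U n ≈ x → U (orbitSum n x) ≈ orbitSum n x
    orbitSum-invariant n {x} Uⁿx≈x = ∙-cancelˡ x _ _ (begin
      x + U (orbitSum n x)       ≈⟨ orbitSum-shift n x ⟩
      orbitSum n x + fold x U n  ≈⟨ +-congˡ Uⁿx≈x ⟩
      orbitSum n x + x           ≈⟨ +-comm _ _ ⟩
      x + orbitSum n x           ∎)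

    orbitSum-commute : ∀ {S} → IsEndo S → (∀ x → S (U x) ≈ U (S x)) →
                       ∀ n x → S (orbitSum n x) ≈ orbitSum n (S x)
    orbitSum-commute S-endo SU≈US zero    x = IsMonoidHomomorphism.ε-homo S-endo
    orbitSum-commute S-endo SU≈US (suc n) x =
      ≈-trans (IsMonoidHomomorphism.homo S-endo _ _)
        (+-congˡ (≈-trans (SU≈US _) (⟦⟧-cong (orbitSum-commute S-endo SU≈US n x))))

  -- Cancelling multiples in a group killed by `p`.

  module _ {p} (p-torsion : ∀ x → p ⋆ x ≈ 0#) where

    ⋆-kill : ∀ n x → (n ℕ.* p) ⋆ x ≈ 0#
    ⋆-kill n x = begin
      (n ℕ.* p) ⋆ x  ≡⟨ cong (_⋆ x) (ℕ.*-comm n p) ⟩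
      (p ℕ.* n) ⋆ x  ≈⟨ ×-assocˡ x p n ⟨
      p ⋆ n ⋆ x      ≈⟨ p-torsion (n ⋆ x) ⟩
      0#             ∎

    -- Bézout's identity provides an inverse of `q` modulo `p`. It is returned as a map and not as a
    -- natural number because in the case `1 + a q = b p` the inverse is `-a`.
    ⋆-leftInverse : ∀ {q} → Coprime q p →
                    ∃[ g ] (∀ {x y} → x ≈ y → g x ≈ g y) × (∀ x → g (q ⋆ x) ≈ x)
    ⋆-leftInverse {q} coprime with coprime-Bézout coprime
    ... | Bézout.+- a b 1+bp≡aq = a ⋆_ , ×-congʳ a , λ x → begin
      a ⋆ q ⋆ x              ≈⟨ ×-assocˡ x a q ⟩
      (a ℕ.* q) ⋆ x          ≡⟨ cong (_⋆ x) 1+bp≡aq ⟨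
      x + (b ℕ.* p) ⋆ x      ≈⟨ +-congˡ (⋆-kill b x) ⟩
      x + 0#                 ≈⟨ +-identityʳ x ⟩
      x                      ∎
    ... | Bézout.-+ a b 1+aq≡bp =
      (λ x → - (a ⋆ x)) , (λ x≈y → AbelianGroup.⁻¹-cong V (×-congʳ a x≈y)) , λ x →
        ≈-sym (inverseˡ-unique x (a ⋆ q ⋆ x) (begin
          x + a ⋆ q ⋆ x      ≈⟨ +-congˡ (×-assocˡ x a q) ⟩
          (1 ℕ.+ a ℕ.* q) ⋆ x  ≡⟨ cong (_⋆ x) 1+aq≡bp ⟩
          (b ℕ.* p) ⋆ x      ≈⟨ ⋆-kill b x ⟩
          0#                 ∎))

    ⋆-cancel : ∀ {q} → Coprime q p → ∀ {x y} → q ⋆ x ≈ q ⋆ y → x ≈ y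
    ⋆-cancel coprime {x} {y} qx≈qy with ⋆-leftInverse coprime
    ... | g , g-cong , g-inverse = ≈-trans (≈-sym (g-inverse x)) (≈-trans (g-cong qx≈qy) (g-inverse y))

  -- Iterates of `T` and their fixed points.

  module Iteration {T : Carrier → Carrier} (T-endo : IsEndo T) where

    T^_ : ℕ → Carrier → Carrier
    (T^ n) x = fold x T n

    module T^ n = IsMonoidHomomorphism (fold-endo T-endo n)

    Fixed : ℕ → Carrier → Set ℓ
    Fixed n x = (T^ n) x ≈ x

    T^-+ : ∀ m n x → (T^ (m ℕ.+ n)) x ≡ (T^ m) ((T^ n) x)
    T^-+ m n x = fold-+ x T m

    T^-comm : ∀ m n x → (T^ m) ((T^ n) x) ≡ (T^ n) ((T^ m) x)
    T^-comm m n x = ≡.trans (≡.sym (T^-+ m n x))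
      (≡.trans (cong (λ l → (T^ l) x) (ℕ.+-comm m n)) (T^-+ n m x))

    T^-* : ∀ m n x → (T^ (m ℕ.* n)) x ≡ fold x (T^ n) m
    T^-* zero    n x = refl
    T^-* (suc m) n x = ≡.trans (T^-+ n (m ℕ.* n) x) (cong (T^ n) (T^-* m n x))

    fixed-* : ∀ m {n x} → Fixed n x → Fixed (m ℕ.* n) x
    fixed-* zero    fixed = ≈-refl
    fixed-* (suc m) {n} {x} fixed = begin
      (T^ (n ℕ.+ m ℕ.* n)) x      ≡⟨ T^-+ n (m ℕ.* n) x ⟩
      (T^ n) ((T^ (m ℕ.* n)) x)   ≈⟨ T^.⟦⟧-cong n (fixed-* m fixed) ⟩
      (T^ n) x                    ≈⟨ fixed ⟩
      x                           ∎

    fixed-∣ : ∀ {m n x} → m ∣ n → Fixed m x → Fixed n x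
    fixed-∣ (divides-refl c) = fixed-* c

    -- Periods can be subtracted without inverting `T`: in `T^m x` the argument `x` may be replaced
    -- by `T^n x`.
    fixed-∸ : ∀ m n {x} → Fixed n x → Fixed (m ℕ.+ n) x → Fixed m x
    fixed-∸ m n {x} fixedₙ fixedₘ₊ₙ = begin
      (T^ m) x            ≈⟨ T^.⟦⟧-cong m fixedₙ ⟨
      (T^ m) ((T^ n) x)   ≡⟨ T^-+ m n x ⟨
      (T^ (m ℕ.+ n)) x    ≈⟨ fixedₘ₊ₙ ⟩
      x                   ∎

    -- Bézout's identity in ℕ says that the gcd plus a multiple of one number is a multiple of the
    -- other. Both multiples are periods of `x`, so `fixed-∸` leaves the gcd.
    fixed-gcd : ∀ m n {x} → Fixed m x → Fixed n x → Fixed (GCD.gcd m n) x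
    fixed-gcd m n {x} fixedₘ fixedₙ with Bézout.identity (gcd-GCD m n)
    ... | Bézout.+- a b eq = fixed-∸ (GCD.gcd m n) (b ℕ.* n) (fixed-* b fixedₙ)
      (subst (λ l → Fixed l x) (≡.sym eq) (fixed-* a fixedₘ))
    ... | Bézout.-+ a b eq = fixed-∸ (GCD.gcd m n) (a ℕ.* m) (fixed-* a fixedₘ)
      (subst (λ l → Fixed l x) (≡.sym eq) (fixed-* b fixedₙ))

    fixed-+-cancelˡ : ∀ n {x y} → Fixed n x → Fixed n (x + y) → Fixed n y
    fixed-+-cancelˡ n {x} {y} fixedˣ fixed = ∙-cancelˡ x _ _ (begin
      x + (T^ n) y          ≈⟨ +-congʳ fixedˣ ⟨
      (T^ n) x + (T^ n) y   ≈⟨ T^.homo n x y ⟨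
      (T^ n) (x + y)        ≈⟨ fixed ⟩
      x + y                 ∎)

    module Orbit {k} {{_ : ℕ.NonZero k}} (T^k≈id : ∀ x → Fixed k x) where

      -- Since `T^k` is the identity, `T^(k-1)` is a left inverse of `T`.
      T-injective : ∀ {x y} → T x ≈ T y → x ≈ y
      T-injective {x} {y} Tx≈Ty = begin
        x                       ≈⟨ pred-inverse x ⟨
        (T^ (ℕ.pred k)) (T x)   ≈⟨ T^.⟦⟧-cong (ℕ.pred k) Tx≈Ty ⟩
        (T^ (ℕ.pred k)) (T y)   ≈⟨ pred-inverse y ⟩
        y                       ∎
        where
        pred-inverse : ∀ x → (T^ (ℕ.pred k)) (T x) ≈ x
        pred-inverse x = begin
          (T^ (ℕ.pred k)) (T x)    ≡⟨ T^-+ (ℕ.pred k) 1 x ⟨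
          (T^ (ℕ.pred k ℕ.+ 1)) x  ≡⟨ cong (λ n → (T^ n) x)
                                        (≡.trans (ℕ.+-comm (ℕ.pred k) 1) (ℕ.suc-pred k)) ⟩
          (T^ k) x                 ≈⟨ T^k≈id x ⟩
          x                        ∎

      T^-% : ∀ n x → (T^ (n % k)) x ≈ (T^ n) x
      T^-% n x = begin
        (T^ (n % k)) x                        ≈⟨ T^.⟦⟧-cong (n % k) (fixed-* (n / k) (T^k≈id x)) ⟨
        (T^ (n % k)) ((T^ (n / k ℕ.* k)) x)   ≡⟨ T^-+ (n % k) (n / k ℕ.* k) x ⟨
        (T^ (n % k ℕ.+ n / k ℕ.* k)) x        ≡⟨ cong (λ l → (T^ l) x) (m≡m%n+[m/n]*n n k) ⟨
        (T^ n) x                              ∎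

      module _ {v} (aperiodic : ∀ j → 0 < j → j < k → ¬ Fixed j v) where

        -- Cancelling `T` on both sides `i` times turns a coincidence into `v = T^(j-i) v` with
        -- `0 < j-i < k`.
        orbit-distinct : ∀ {i j} → i < j → j < k → ¬ (T^ i) v ≈ (T^ j) v
        orbit-distinct {zero}  i<j j<k eq = aperiodic _ i<j j<k (≈-sym eq)
        orbit-distinct {suc i} {suc j} i<j j<k eq =
          orbit-distinct (ℕ.s<s⁻¹ i<j) (ℕ.<-trans (ℕ.n<1+n j) j<k) (T-injective eq)

        orbit-injective : ∀ {i j} → i < k → j < k → (T^ i) v ≈ (T^ j) v → i ≡ j
        orbit-injective {i} {j} i<k j<k eq with ℕ.<-cmp i j
        ... | tri< i<j _ _ = contradiction eq (orbit-distinct i<j j<k)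
        ... | tri≈ _ i≡j _ = i≡j
        ... | tri> _ _ j<i = contradiction (≈-sym eq) (orbit-distinct j<i i<k)

    -- Construction of a vector that no `T^j` with `0 < j < k` fixes.

    module _ (_≈?_ : Decidable _≈_) {p} (p-torsion : ∀ x → p ⋆ x ≈ 0#) where

      fixed-⋆-cancel : ∀ {q} → Coprime q p → ∀ n {x} → Fixed n (q ⋆ x) → Fixed n x
      fixed-⋆-cancel {q} coprime n {x} fixed = ⋆-cancel p-torsion coprime
        (≈-trans (≈-sym (⋆-homo (fold-endo T-endo n) q x)) fixed)

      -- For q prime to p, N = Σ_{i<q} T^{di} is q times the projection onto the
      -- fixed space of T^d. So w' = q w - N w ≠ 0 is killed by N, whereas N v = q v;
      -- hence T^d moves v + w', and as N preserves every fixed space, so does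
      -- each T^e that moves v.
      avoid-fixed : ∀ {q} → Coprime q p → ∀ d → (∀ x → Fixed (q ℕ.* d) x) →
                    ∀ v {w} → ¬ Fixed d w →
                    ∃[ v′ ] ¬ Fixed d v′ × (∀ e → ¬ Fixed e v → ¬ Fixed e v′)
      avoid-fixed {q} coprime d T^qd≈id v {w} ¬fixedʷ with (T^ d) v ≈? v
      ... | no ¬fixedᵛ = v , ¬fixedᵛ , λ e ¬fixed → ¬fixed
      ... | yes fixedᵛ = v + w′ , moved , preserved
        where
        N : Carrier → Carrier
        N = orbitSum (fold-endo T-endo d) q

        module N = IsMonoidHomomorphism (orbitSum-endo (fold-endo T-endo d) q)

        w′ : Carrier
        w′ = q ⋆ w + - N w

        w′+Nw≈qw : w′ + N w ≈ q ⋆ w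
        w′+Nw≈qw = begin
          q ⋆ w + - N w + N w     ≈⟨ +-assoc _ _ _ ⟩
          q ⋆ w + (- N w + N w)   ≈⟨ +-congˡ (-‿inverseˡ (N w)) ⟩
          q ⋆ w + 0#              ≈⟨ +-identityʳ _ ⟩
          q ⋆ w                   ∎

        N-fixed : ∀ x → Fixed d (N x)
        N-fixed x = orbitSum-invariant (fold-endo T-endo d) q
          (≈-trans (≈-reflexive (≡.sym (T^-* q d x))) (T^qd≈id x))

        -- Since `N w` is fixed by `T^d`, `N (N w) = q N w = N (q w)`. As `w′ + N w = q w`, adding
        -- `N w′` to `N (N w)` changes nothing.
        Nw′≈0 : N w′ ≈ 0#
        Nw′≈0 = identityˡ-unique (N w′) (N (N w)) (begin
          N w′ + N (N w)   ≈⟨ N.homo w′ (N w) ⟨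
          N (w′ + N w)     ≈⟨ N.⟦⟧-cong w′+Nw≈qw ⟩
          N (q ⋆ w)        ≈⟨ ⋆-homo (orbitSum-endo (fold-endo T-endo d) q) q w ⟩
          q ⋆ N w          ≈⟨ orbitSum-fixed (fold-endo T-endo d) q (N-fixed w) ⟨
          N (N w)          ∎)

        moved : ¬ Fixed d (v + w′)
        -- As `T^d` fixes `v`, it would also fix `w′`, so `q w′ = N w′ = 0` and `w′ = 0`. Then
        -- `q w = N w` would be fixed, and after cancelling `q` so would `w`.
        moved fixed = ¬fixedʷ (fixed-⋆-cancel coprime d (≈-trans (T^.⟦⟧-cong d qw≈Nw)
            (≈-trans (N-fixed w) (≈-sym qw≈Nw))))
          where
          w′≈0 : w′ ≈ 0#
          w′≈0 = ⋆-cancel p-torsion coprime (begin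
            q ⋆ w′   ≈⟨ orbitSum-fixed (fold-endo T-endo d) q (fixed-+-cancelˡ d fixedᵛ fixed) ⟨
            N w′     ≈⟨ Nw′≈0 ⟩
            0#       ≈⟨ N.ε-homo ⟨
            N 0#     ≈⟨ orbitSum-fixed (fold-endo T-endo d) q (T^.ε-homo d) ⟩
            q ⋆ 0#   ∎)

          qw≈Nw : q ⋆ w ≈ N w
          qw≈Nw = ≈-trans (≈-sym w′+Nw≈qw) (≈-trans (+-congʳ w′≈0) (+-identityˡ _))

        N[v+w′]≈qv : N (v + w′) ≈ q ⋆ v
        N[v+w′]≈qv = begin
          N (v + w′)    ≈⟨ N.homo v w′ ⟩
          N v + N w′    ≈⟨ +-cong (orbitSum-fixed (fold-endo T-endo d) q fixedᵛ) Nw′≈0 ⟩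
          q ⋆ v + 0#    ≈⟨ +-identityʳ _ ⟩
          q ⋆ v         ∎

        preserved : ∀ e → ¬ Fixed e v → ¬ Fixed e (v + w′)
        preserved e ¬fixedᵛ fixed = ¬fixedᵛ (fixed-⋆-cancel coprime e (begin
          (T^ e) (q ⋆ v)        ≈⟨ T^.⟦⟧-cong e N[v+w′]≈qv ⟨
          (T^ e) (N (v + w′))   ≈⟨ orbitSum-commute (fold-endo T-endo d) (fold-endo T-endo e)
                                     (λ x → ≈-reflexive (T^-comm e d x)) q (v + w′) ⟩
          N ((T^ e) (v + w′))   ≈⟨ N.⟦⟧-cong fixed ⟩
          N (v + w′)            ≈⟨ N[v+w′]≈qv ⟩
          q ⋆ v                 ∎))

      module _ (p-prime : Prime p) {k} (0<k : 0 < k) (T^k≈id : ∀ x → Fixed k x)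
               (moves : ∀ j → 0 < j → j < k → ∃[ w ] ¬ Fixed j w) where

        cofactor-bounds : ∀ {q d} → Prime q → q ℕ.* d ≡ k → 0 < d × d < k
        cofactor-bounds {q} {zero} q-prime qd≡k =
          contradiction (≡.trans (≡.sym (ℕ.*-zeroʳ q)) qd≡k) (ℕ.<⇒≢ 0<k)
        cofactor-bounds {q} {d@(suc _)} q-prime refl =
          z<s , subst (d <_) (ℕ.*-comm d q)
            (ℕ.m<m*n d q (ℕ.nonTrivial⇒n>1 q {{prime⇒nonTrivial q-prime}}))

        -- The invariant of a recursion on `b` through the candidate primes: `T^(k/q)` moves `v` for
        -- each prime divisor `q` of `k` treated so far. The disjunct `q ≡ p` puts `p` among these
        -- from stage 0 on.
        Generic : ℕ → Carrier → Set ℓ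
        Generic b v = ∀ {q d} → Prime q → q ℕ.* d ≡ k → q < b ⊎ q ≡ p → ¬ Fixed d v

        -- Passing from `b` to `suc b` adds at most the prime `b`, and adds nothing if `b` is `p`,
        -- whose condition is already part of the invariant.
        extend : ∀ {b v} → (∀ d → Prime b → b ℕ.* d ≡ k → b ≢ p → ¬ Fixed d v) →
                 Generic b v → Generic (suc b) v
        extend new gen q-prime qd≡k (inj₂ q≡p) = gen q-prime qd≡k (inj₂ q≡p)
        extend new gen {q} q-prime qd≡k (inj₁ q<1+b) with q ℕ.≟ p | ℕ.m<1+n⇒m<n∨m≡n q<1+b
        ... | yes q≡p | _         = gen q-prime qd≡k (inj₂ q≡p)
        ... | no _    | inj₁ q<b  = gen q-prime qd≡k (inj₁ q<b)
        ... | no q≢p  | inj₂ refl = new _ q-prime qd≡k q≢p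

        -- The prime p must come first, since avoid-fixed does not apply to it.
        generic : ∀ b → ∃[ v ] Generic b v
        generic zero with p Div.∣? k
        -- No prime lies below 0 and `p` has no cofactor in `k`, so the condition is vacuous and any
        -- vector would serve.
        ... | no p∤k = 0# , λ { {d = d} q-prime qd≡k (inj₂ refl) →
                contradiction (divides d (≡.trans (≡.sym qd≡k) (ℕ.*-comm p d))) p∤k }
        ... | yes (divides d k≡dp)
          using 0<d , d<k ← cofactor-bounds p-prime (≡.trans (ℕ.*-comm p d) (≡.sym k≡dp))
          using w , ¬fixed ← moves d 0<d d<k =
          -- The cofactor of `p` in `k` is unique, so a vector moved by `T^d` settles every `d′`
          -- with `p d′ = k`.
          w , λ { {d = d′} _ pd′≡k (inj₂ refl) → subst (λ l → ¬ Fixed l w)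
                (ℕ.*-cancelˡ-≡ d d′ p {{prime⇒nonZero p-prime}}
                  (≡.trans (ℕ.*-comm p d) (≡.trans (≡.sym k≡dp) (≡.sym pd′≡k)))) ¬fixed }
        -- The vector changes only when `b` is a prime divisor of `k` other than `p`. Then `b` is
        -- coprime to `p`, and `avoid-fixed` yields a vector moved by `T^(k/b)` and by each power
        -- that moved the old one.
        generic (suc b) with generic b | prime? b | b Div.∣? k | b ℕ.≟ p
        ... | v , gen | no ¬prime | _      | _        =
          v , extend (λ _ b-prime → contradiction b-prime ¬prime) gen
        ... | v , gen | yes _     | no b∤k | _        =
          v , extend (λ d _ bd≡k → contradiction
            (divides d (≡.trans (≡.sym bd≡k) (ℕ.*-comm b d))) b∤k) gen
        ... | v , gen | yes _     | yes _  | yes b≡p  =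
          v , extend (λ _ _ _ b≢p → contradiction b≡p b≢p) gen
        ... | v , gen | yes b-prime | yes (divides d k≡db) | no b≢p
          using bd≡k ← ≡.trans (ℕ.*-comm b d) (≡.sym k≡db)
          using 0<d , d<k ← cofactor-bounds b-prime bd≡k
          using w , ¬fixedʷ ← moves d 0<d d<k
          using v′ , ¬fixed , preserved ← avoid-fixed (distinct-primes-coprime b-prime p-prime b≢p) d
                  (λ x → subst (λ l → Fixed l x) (≡.sym bd≡k) (T^k≈id x)) v ¬fixedʷ =
          v′ , extend
            (λ d′ _ bd′≡k _ → subst (λ l → ¬ Fixed l v′)
              (ℕ.*-cancelˡ-≡ d d′ b {{prime⇒nonZero b-prime}} (≡.trans bd≡k (≡.sym bd′≡k))) ¬fixed)
            (λ {q} {e} q-prime qd≡k q<b → preserved e (gen q-prime qd≡k q<b))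

        -- A period `j < k` would make `gcd j k`, a proper divisor of `k`, a period, and hence some
        -- `k/q` with `q` prime. Stage `suc k` of the recursion covers every such `q`, as `q ≤ k`.
        aperiodic : ∃[ v ] ∀ j → 0 < j → j < k → ¬ Fixed j v
        aperiodic with generic (suc k)
        ... | v , gen = v , λ j 0<j j<k fixed →
          let gcd≤j = Div.∣⇒≤ {{ℕ.>-nonZero 0<j}} (gcd[m,n]∣m j k)
              q , d , q-prime , qd≡k , gcd∣d =
                maximal-proper-divisor 0<k (ℕ.≤-<-trans gcd≤j j<k) (gcd[m,n]∣n j k)
              q≤k = Div.∣⇒≤ {{ℕ.>-nonZero 0<k}} (divides d (≡.trans (≡.sym qd≡k) (ℕ.*-comm q d)))
          in gen q-prime qd≡k (inj₁ (s≤s q≤k))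
               (fixed-∣ gcd∣d (fixed-gcd j k fixed (T^k≈id v)))

    -- The orbit of an aperiodic vector as a directed cycle.

    -- Vertices are compared by `_≡_` but group elements by `_≈_`; `lift` and `reduce` translate
    -- between the two. An arc from vertex `i` to vertex `j` then amounts to `T^j v = T^(i+1) v`.
    orbit-cycle : ∀ {G : Digraph} {lift : Digraph.Vertex G → Carrier}
                    {reduce : Carrier → Digraph.Vertex G} →
                  (∀ x → lift (reduce x) ≈ x) →
                  (∀ {x y} → Digraph.Arc G x y → lift y ≈ T (lift x)) →
                  (∀ {x y} → lift y ≈ T (lift x) → Digraph.Arc G x y) →
                  Decidable _≈_ → ∀ {p} → Prime p → (∀ x → p ⋆ x ≈ 0#) →
                  ∀ {k} → 0 < k → (∀ x → Fixed k x) →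
                  (∀ j → 0 < j → j < k → ∃[ w ] ¬ Fixed j w) →
                  DirectedCycle G k
    orbit-cycle {G} {lift} {reduce} lift-reduce arc⇒ ⇒arc _≈?_ p-prime p-torsion {k} 0<k T^k≈id moves
      with aperiodic _≈?_ p-torsion p-prime 0<k T^k≈id moves
    ... | v , v-aperiodic = record
      { positive  = 0<k
      ; vertex    = vertex
      ; distinct  = distinct
      ; adjacent  = λ i → fwd (power⇒arc i (next i) (next-power i))
      -- Two predecessors of one vertex have equal images under `T`, so injectivity of `T`
      -- identifies them.
      ; inDegree  = λ i → previous i , power⇒arc (previous i) i (previous-power i) ,
          λ {j} arc → same-power (T-injective
            (≈-trans (≈-sym (previous-power i)) (arc⇒power j i arc)))
      ; outDegree = λ i → next i , power⇒arc i (next i) (next-power i) ,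
          λ {j} arc → same-power
            (≈-trans (next-power i) (≈-sym (arc⇒power i j arc)))
      }
      where
      instance
        k-nonZero : ℕ.NonZero k
        k-nonZero = ℕ.>-nonZero 0<k

      open Orbit {k} T^k≈id

      vertex : Fin k → Digraph.Vertex G
      vertex i = reduce ((T^ toℕ i) v)

      same-power : ∀ {i j} → (T^ toℕ i) v ≈ (T^ toℕ j) v → i ≡ j
      same-power {i} {j} eq = Fin.toℕ-injective
        (orbit-injective v-aperiodic (Fin.toℕ<n i) (Fin.toℕ<n j) eq)

      distinct : ∀ {i j} → vertex i ≡ vertex j → i ≡ j
      distinct {i} {j} eq = same-power (begin
        (T^ toℕ i) v     ≈⟨ lift-reduce ((T^ toℕ i) v) ⟨
        lift (vertex i)  ≡⟨ cong lift eq ⟩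
        lift (vertex j)  ≈⟨ lift-reduce ((T^ toℕ j) v) ⟩
        (T^ toℕ j) v     ∎)

      Arc : Fin k → Fin k → Set
      Arc i j = Digraph.Arc G (vertex i) (vertex j)

      power⇒arc : ∀ i j → (T^ toℕ j) v ≈ (T^ suc (toℕ i)) v → Arc i j
      power⇒arc i j eq = ⇒arc (begin
        lift (vertex j)      ≈⟨ lift-reduce ((T^ toℕ j) v) ⟩
        (T^ toℕ j) v         ≈⟨ eq ⟩
        T ((T^ toℕ i) v)     ≈⟨ T^.⟦⟧-cong 1 (lift-reduce ((T^ toℕ i) v)) ⟨
        T (lift (vertex i))  ∎)

      arc⇒power : ∀ i j → Arc i j → (T^ toℕ j) v ≈ (T^ suc (toℕ i)) v
      arc⇒power i j arc = begin
        (T^ toℕ j) v         ≈⟨ lift-reduce ((T^ toℕ j) v) ⟨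
        lift (vertex j)      ≈⟨ arc⇒ arc ⟩
        T (lift (vertex i))  ≈⟨ T^.⟦⟧-cong 1 (lift-reduce ((T^ toℕ i) v)) ⟩
        T ((T^ toℕ i) v)     ∎

      toℕ-mod : ∀ n → toℕ (n mod k) ≡ n % k
      toℕ-mod n = Fin.toℕ-fromℕ< (m%n<n n k)

      next-power : ∀ i → (T^ toℕ (next i)) v ≈ (T^ suc (toℕ i)) v
      next-power i = begin
        (T^ toℕ (next i)) v          ≡⟨ cong (λ l → (T^ l) v) (toℕ-mod (suc (toℕ i))) ⟩
        (T^ (suc (toℕ i) % k)) v     ≈⟨ T^-% (suc (toℕ i)) v ⟩
        (T^ suc (toℕ i)) v           ∎

      -- This is `i - 1` modulo `k`; adding `k - 1` keeps the computation in ℕ at `i = 0`.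
      previous : Fin k → Fin k
      previous i = (toℕ i ℕ.+ ℕ.pred k) mod k

      previous-power : ∀ i → (T^ toℕ i) v ≈ (T^ suc (toℕ (previous i))) v
      previous-power i = begin
        (T^ toℕ i) v                               ≈⟨ T^.⟦⟧-cong (toℕ i) (T^k≈id v) ⟨
        (T^ toℕ i) ((T^ k) v)                      ≡⟨ T^-+ (toℕ i) k v ⟨
        (T^ (toℕ i ℕ.+ k)) v                       ≡⟨ cong (λ l → (T^ l) v) i+k≡1+[i+k-1] ⟩
        T ((T^ (toℕ i ℕ.+ ℕ.pred k)) v)            ≈⟨ T^.⟦⟧-cong 1 (T^-% (toℕ i ℕ.+ ℕ.pred k) v) ⟨
        T ((T^ ((toℕ i ℕ.+ ℕ.pred k) % k)) v)      ≡⟨ cong (λ l → T ((T^ l) v)) (toℕ-mod (toℕ i ℕ.+ ℕ.pred k)) ⟨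
        (T^ suc (toℕ (previous i))) v              ∎
        where
        i+k≡1+[i+k-1] : toℕ i ℕ.+ k ≡ suc (toℕ i ℕ.+ ℕ.pred k)
        i+k≡1+[i+k-1] = ≡.trans (cong (toℕ i ℕ.+_) (≡.sym (ℕ.suc-pred k))) (ℕ.+-suc (toℕ i) (ℕ.pred k))

-- Matrices acting on vectors over a commutative ring.

module MatrixAction {c ℓ} (R : CommutativeRing c ℓ) where

  open CommutativeRing R hiding (zero)
  open Matrices R
  open import Algebra.Properties.Semiring.Sum semiring
    using (sum; sum-cong-≋; sum-replicate-zero; ∑-distrib-+; ∑-comm; *-distribˡ-sum; *-distribʳ-sum)

  infix 4 _≈ᵥ_
  _≈ᵥ_ : ∀ {m} → Vector Carrier m → Vector Carrier m → Set ℓ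
  x ≈ᵥ y = ∀ i → x i ≈ y i

  ·ᵥ-cong : ∀ {m} (A : Mat m) {x y} → x ≈ᵥ y → A ·ᵥ x ≈ᵥ A ·ᵥ y
  ·ᵥ-cong A x≈y i = sum-cong-≋ λ j → *-congˡ (x≈y j)

  ·ᵥ-endo : ∀ {m} (A : Mat m) →
            Endomorphisms.IsEndo (Pointwise.abelianGroup (Fin m) +-abelianGroup) (A ·ᵥ_)
  ·ᵥ-endo {m} A = record
    { isMagmaHomomorphism = record
      { isRelHomomorphism = record { cong = ·ᵥ-cong A }
      ; homo = λ x y i → trans (sum-cong-≋ λ j → distribˡ (A i j) (x j) (y j))
                               (∑-distrib-+ (λ j → A i j * x j) (λ j → A i j * y j))
      }
    ; ε-homo = λ i → trans (sum-cong-≋ λ j → zeroʳ (A i j)) (sum-replicate-zero m)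
    }

  ·ᵥ-assoc : ∀ {m} (A B : Mat m) x → (A · B) ·ᵥ x ≈ᵥ A ·ᵥ (B ·ᵥ x)
  ·ᵥ-assoc A B x i = begin
    sum (λ j → sum (λ l → A i l * B l j) * x j)
      ≈⟨ sum-cong-≋ (λ j → trans (*-distribʳ-sum (x j) λ l → A i l * B l j)
                                 (sum-cong-≋ λ l → *-assoc (A i l) (B l j) (x j))) ⟩
    sum (λ j → sum λ l → A i l * (B l j * x j))
      ≈⟨ ∑-comm (λ j l → A i l * (B l j * x j)) ⟩
    sum (λ l → sum λ j → A i l * (B l j * x j))
      ≈⟨ sum-cong-≋ (λ l → *-distribˡ-sum (A i l) λ j → B l j * x j) ⟨
    sum (λ l → A i l * sum λ j → B l j * x j)
      ∎
    where open SetoidReasoning setoid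

  𝟙-·ᵥ : ∀ {m} (x : Vector Carrier m) → 𝟙 ·ᵥ x ≈ᵥ x
  𝟙-·ᵥ {suc m} x Fin.zero = trans
    (+-cong (*-identityˡ _) (trans (sum-cong-≋ λ j → zeroˡ (x (Fin.suc j))) (sum-replicate-zero m)))
    (+-identityʳ _)
  -- Deleting the first row and column of `𝟙` leaves `𝟙` by computation, because
  -- `does (suc i ≟ suc j)` reduces to `does (i ≟ j)`.
  𝟙-·ᵥ {suc m} x (Fin.suc i) = trans
    (+-cong (zeroˡ _) (𝟙-·ᵥ (λ j → x (Fin.suc j)) i))
    (+-identityˡ _)

  ^ᵐ-·ᵥ : ∀ {m} (A : Mat m) k x → (A ^ᵐ k) ·ᵥ x ≈ᵥ fold x (A ·ᵥ_) k
  ^ᵐ-·ᵥ A zero    x   = 𝟙-·ᵥ x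
  ^ᵐ-·ᵥ A (suc k) x i = trans (·ᵥ-assoc A (A ^ᵐ k) x i) (·ᵥ-cong A (^ᵐ-·ᵥ A k x) i)

-- The integers modulo `n`, and residue vectors.

module Modular (n : ℕ) where

  infix 4 _≈_
  _≈_ : ℤ → ℤ → Set
  i ≈ j = i ≡ j [mod n ]

  private
    -- Each congruence law below rewrites a difference as a combination of differences known to be
    -- divisible by `n`.
    via : ∀ {i j} → i ≡ j → + n ℤ∣.∣ j → + n ℤ∣.∣ i
    via i≡j = subst (+ n ℤ∣.∣_) (≡.sym i≡j)

  ≈-reflexive : ∀ {i j} → i ≡ j → i ≈ j
  ≈-reflexive {i} refl = via (ℤ.+-inverseʳ i) (ℤ∣.divides ℤ.0ℤ refl)

  ≈-sym : ∀ {i j} → i ≈ j → j ≈ i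
  ≈-sym {i} {j} i≈j = via (lemma i j) (ℤ∣.∣m⇒∣-m i≈j)
    where
    lemma : ∀ i j → j ℤ.- i ≡ ℤ.- (i ℤ.- j)
    lemma = solve-∀

  ≈-trans : ∀ {i j k} → i ≈ j → j ≈ k → i ≈ k
  ≈-trans {i} {j} {k} i≈j j≈k = via (lemma i j k) (ℤ∣.∣m∣n⇒∣m+n i≈j j≈k)
    where
    lemma : ∀ i j k → i ℤ.- k ≡ (i ℤ.- j) ℤ.+ (j ℤ.- k)
    lemma = solve-∀

  +-cong : ∀ {i j k l} → i ≈ j → k ≈ l → i ℤ.+ k ≈ j ℤ.+ l
  +-cong {i} {j} {k} {l} i≈j k≈l = via (lemma i j k l) (ℤ∣.∣m∣n⇒∣m+n i≈j k≈l)
    where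
    lemma : ∀ i j k l → (i ℤ.+ k) ℤ.- (j ℤ.+ l) ≡ (i ℤ.- j) ℤ.+ (k ℤ.- l)
    lemma = solve-∀

  *-cong : ∀ {i j k l} → i ≈ j → k ≈ l → i ℤ.* k ≈ j ℤ.* l
  *-cong {i} {j} {k} {l} i≈j k≈l =
    via (lemma i j k l) (ℤ∣.∣m∣n⇒∣m+n (ℤ∣.∣m⇒∣m*n k i≈j) (ℤ∣.∣n⇒∣m*n j k≈l))
    where
    lemma : ∀ i j k l → i ℤ.* k ℤ.- j ℤ.* l ≡ (i ℤ.- j) ℤ.* k ℤ.+ j ℤ.* (k ℤ.- l)
    lemma = solve-∀

  -‿cong : ∀ {i j} → i ≈ j → ℤ.- i ≈ ℤ.- j
  -‿cong {i} {j} i≈j = via (lemma i j) (ℤ∣.∣m⇒∣-m i≈j)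
    where
    lemma : ∀ i j → ℤ.- i ℤ.- ℤ.- j ≡ ℤ.- (i ℤ.- j)
    lemma = solve-∀

  -- The carrier and operations remain those of ℤ and only equality is coarsened, so integer
  -- matrices and vectors need no conversion.
  commutativeRing : CommutativeRing _ _
  commutativeRing = record
    { _≈_ = _≈_
    ; _+_ = ℤ._+_
    ; _*_ = ℤ._*_
    ; -_  = ℤ.-_
    ; 0#  = ℤ.0ℤ
    ; 1#  = ℤ.1ℤ
    ; isCommutativeRing = record
      { isRing = record
        { +-isAbelianGroup = record
          { isGroup = record
            { isMonoid = record
              { isSemigroup = record
                { isMagma = record
                  { isEquivalence = record
                    { refl  = λ {i} → ≈-reflexive {i} refl
                    ; sym   = λ {i j} → ≈-sym {i} {j}
                    ; trans = λ {i j k} → ≈-trans {i} {j} {k}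
                    }
                  ; ∙-cong = λ {i j k l} → +-cong {i} {j} {k} {l}
                  }
                ; assoc = λ i j k → ≈-reflexive (ℤ.+-assoc i j k)
                }
              ; identity = (λ i → ≈-reflexive (ℤ.+-identityˡ i)) , (λ i → ≈-reflexive (ℤ.+-identityʳ i))
              }
            ; inverse = (λ i → ≈-reflexive (ℤ.+-inverseˡ i)) , (λ i → ≈-reflexive (ℤ.+-inverseʳ i))
            ; ⁻¹-cong = λ {i j} → -‿cong {i} {j}
            }
          ; comm = λ i j → ≈-reflexive (ℤ.+-comm i j)
          }
        ; *-cong = λ {i j k l} → *-cong {i} {j} {k} {l}
        ; *-assoc = λ i j k → ≈-reflexive (ℤ.*-assoc i j k)
        ; *-identity = (λ i → ≈-reflexive (ℤ.*-identityˡ i)) , (λ i → ≈-reflexive (ℤ.*-identityʳ i))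
        ; distrib = (λ i j k → ≈-reflexive (ℤ.*-distribˡ-+ i j k)) , (λ i j k → ≈-reflexive (ℤ.*-distribʳ-+ i j k))
        }
      ; *-comm = λ i j → ≈-reflexive (ℤ.*-comm i j)
      }
    }

  %ℕ-≈ : .{{_ : ℕ.NonZero n}} → ∀ i → + (i %ℕ n) ≈ i
  %ℕ-≈ i = ≈-sym {i} {+ (i %ℕ n)} (ℤ∣.divides (i /ℕ n) (begin
    i ℤ.- + r                                ≡⟨ cong (ℤ._- + r) (a≡a%ℕn+[a/ℕn]*n i n) ⟩
    + r ℤ.+ (i /ℕ n) ℤ.* + n ℤ.- + r         ≡⟨ lemma (+ r) ((i /ℕ n) ℤ.* + n) ⟩
    (i /ℕ n) ℤ.* + n                         ∎))
    where
    open ≡-Reasoning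
    r : ℕ
    r = i %ℕ n
    lemma : ∀ a b → a ℤ.+ b ℤ.- a ≡ b
    lemma = solve-∀

  vectors : ℕ → AbelianGroup _ _
  vectors m = Pointwise.abelianGroup (Fin m) (CommutativeRing.+-abelianGroup commutativeRing)

  infix 4 _≈ᵥ_ _≈ᵥ?_
  _≈ᵥ_ : ∀ {m} → Vector ℤ m → Vector ℤ m → Set
  x ≈ᵥ y = ∀ i → x i ≈ y i

  _≈ᵥ?_ : ∀ {m} → Decidable (_≈ᵥ_ {m})
  x ≈ᵥ? y = all? λ i → + n ℤ∣.∣? (x i ℤ.- y i)

  n-torsion : ∀ {m} (x : Vector ℤ m) → Endomorphisms._⋆_ (vectors m) n x ≈ᵥ λ _ → ℤ.0ℤ
  n-torsion {m} x i =
    subst (_≈ ℤ.0ℤ) (≡.sym (⋆-lookup n)) (ℤ∣.divides (x i) (lemma (+ n) (x i)))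
    where
    ⋆-lookup : ∀ k → Endomorphisms._⋆_ (vectors m) k x i ≡ + k ℤ.* x i
    ⋆-lookup zero    = refl
    ⋆-lookup (suc k) = ≡.trans (cong (ℤ._+_ (x i)) (⋆-lookup k)) (≡.sym (ℤ.suc-* (+ k) (x i)))

    lemma : ∀ a b → a ℤ.* b ℤ.- ℤ.0ℤ ≡ b ℤ.* a
    lemma = solve-∀

  module _ {{_ : ℕ.NonZero n}} where

    reduce : ∀ {m} → Vector ℤ m → Residues n m
    reduce x = tabulate λ i → fromℕ< (n%ℕd<d (x i) n)

    lift-reduce : ∀ {m} (x : Vector ℤ m) → lift (reduce x) ≈ᵥ x
    lift-reduce x i = subst (_≈ x i) (≡.sym (cong +_ lookup-reduce)) (%ℕ-≈ (x i))
      where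
      lookup-reduce : toℕ (lookup (reduce x) i) ≡ x i %ℕ n
      lookup-reduce = ≡.trans (cong toℕ (lookup∘tabulate _ i)) (Fin.toℕ-fromℕ< (n%ℕd<d (x i) n))

  -- Residue vectors are enumerated by `Fin (n ^ m)`, and over a finite set a decidable predicate
  -- that fails to hold everywhere has a constructive counterexample.
  ¬all-residues : ∀ {m} {P : Residues n m → Set} → (∀ x → Dec (P x)) →
                  ¬ (∀ x → P x) → ∃[ x ] ¬ P x
  ¬all-residues {m} {P} P? ¬∀P
    with Fin.¬∀⟶∃¬ (n ℕ.^ m) _ (λ c → P? (tabulate (finToFun c)))
           (λ ∀P → ¬∀P λ x → subst P (decode x) (∀P (funToFin (lookup x))))
    where
    decode : ∀ x → tabulate (finToFun (funToFin (lookup x))) ≡ x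
    decode x = ≡.trans (tabulate-cong (Fin.finToFun-funToFin (lookup x))) (tabulate∘lookup x)
  ... | c , ¬P = tabulate (finToFun c) , ¬P

-- The action of a matrix of finite order modulo `p`, and the theorem.

module _ {m} (M : Matrix ℤ m) {p} (p-prime : Prime p) {k} (order : IsOrder p M k) where

  open IsOrder order

  private
    instance
      p-nonZero : ℕ.NonZero p
      p-nonZero = prime⇒nonZero p-prime

    R : CommutativeRing _ _
    R = Modular.commutativeRing p

    open Modular p using (_≈ᵥ_; _≈ᵥ?_; n-torsion; reduce; lift-reduce; ¬all-residues)

    T : Vector ℤ m → Vector ℤ m
    T x = M ℤMat.·ᵥ x

    T-endo : Endomorphisms.IsEndo (Modular.vectors p m) T
    T-endo = MatrixAction.·ᵥ-endo R M

    -- Over ℤ, since _^ᵐ_ over different coefficient rings is not judgmentally equal.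
    T-power : ∀ j x i → ((M ℤMat.^ᵐ j) ℤMat.·ᵥ x) i ≡ fold x T j i
    T-power = MatrixAction.^ᵐ-·ᵥ ℤ.+-*-commutativeRing M

    Fixed : ℕ → Vector ℤ m → Set
    Fixed j x = ∀ i → fold x T j i ≡ x i [mod p ]

    mapsTo⇒fixed : ∀ j x → MapsTo p (M ℤMat.^ᵐ j) x x → Fixed j (lift x)
    mapsTo⇒fixed j x maps i = Modular.≈-sym p {lift x i} {fold (lift x) T j i}
      (subst (lift x i ≡_[mod p ]) (T-power j (lift x) i) (maps i))

    fixed⇒mapsTo : ∀ j x → Fixed j (lift x) → MapsTo p (M ℤMat.^ᵐ j) x x
    fixed⇒mapsTo j x fixed i =
      subst (lift x i ≡_[mod p ]) (≡.sym (T-power j (lift x) i))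
        (Modular.≈-sym p {fold (lift x) T j i} {lift x i} (fixed i))

    -- The order hypothesis speaks of lifted residue vectors only; every integer vector is congruent
    -- to the lift of its reduction, and `T^k` respects congruence.
    T^k≈id : ∀ x → Fixed k x
    T^k≈id x = begin
      fold x T k                  ≈⟨ fold-cong (lift-reduce x) ⟨
      fold (lift (reduce x)) T k  ≈⟨ mapsTo⇒fixed k (reduce x) (identity (reduce x)) ⟩
      lift (reduce x)             ≈⟨ lift-reduce x ⟩
      x                           ∎
      where
      open SetoidReasoning (AbelianGroup.setoid (Modular.vectors p m))

      fold-cong : ∀ {x y} → x ≈ᵥ y → fold x T k ≈ᵥ fold y T k
      fold-cong = IsMonoidHomomorphism.⟦⟧-cong
        (Endomorphisms.fold-endo (Modular.vectors p m) T-endo k)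

    -- By leastness of `k`, `M^j` does not act as the identity; finiteness of the vertex set turns
    -- this into an explicit moved vector.
    moves : ∀ j → 0 < j → j < k → ∃[ w ] ¬ Fixed j w
    moves j 0<j j<k =
      let x , ¬maps = ¬all-residues (λ x → lift x ≈ᵥ? ((M ℤMat.^ᵐ j) ℤMat.·ᵥ lift x))
                        (λ all → ℕ.<⇒≱ j<k (least j 0<j all))
      in lift x , λ fixed → ¬maps (fixed⇒mapsTo j x fixed)

  moveGraph-cycle : DirectedCycle (moveGraph M p) k
  moveGraph-cycle = Endomorphisms.Iteration.orbit-cycle (Modular.vectors p m) T-endo
    -- An arc of the move graph is by definition a congruence of `lift y` with `T (lift x)`, so both
    -- translations are identity functions.
    {G = moveGraph M p} {lift} {reduce} lift-reduce (λ arc → arc) (λ maps → maps)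
    _≈ᵥ?_ p-prime n-torsion positive T^k≈id moves

theorem3p6 : ∀ (m : ℕ) (M S : Matrix ℤ m) (S⁻¹ : Matrix ℚ m) →
    ℚMat.IsInverse (toℚMat S) S⁻¹ →
    ℚMat.IsRationalCanonicalFormOf (toℚMat M) (S⁻¹ ℚMat.· toℚMat M ℚMat.· toℚMat S) →
    ∀ (p : ℕ) → Prime p → gcd (ℤMat.det S) (+ p) ≡ 1ℤ →
    ∀ (k : ℕ) → IsOrder p M k →
    DirectedCycle (moveGraph M p) k
theorem3p6 m M S S⁻¹ _ _ p p-prime _ k order = moveGraph-cycle M p-prime order
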